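{- Let $\Gamma = (V,E)$ and $\Sigma = (W,F)$ be two finite connected simple graphs with the same number of vertices and the same number of edges, i.e. $|V| = |W|$ and $|E| = |F|$. Let $\psi : V \to W$ be any bijection between the vertex sets. Then there exists a finite sequence of edge slides which transforms $\Gamma$ into a graph $\widetilde{\Gamma} = (V, \widetilde{E})$ on the same vertex set $V$ such that $\psi : \widetilde{\Gamma} \to \Sigma$ is an isomorphism of graphs, i.e. for all $x,y \in V$, $x$ and $y$ are adjacent in $\widetilde{\Gamma}$ if and only if $\psi(x)$ and $\psi(y)$ are adjacent in $\Sigma$.
   Context: A simple graph $\Gamma = (V,E)$ has no loops and no double edges; write $\overline{xy}$ for the edge joining $x$ and $y$, and $x \sim y$ if $\overline{xy} \in E$. An (edge) slide is the following operation: given three distinct vertices $x,y,z \in V$ with $x \sim y \sim z$ and $x \not\sim z$, replace the edge $\overline{xy}$ by the edge $\overline{xz}$, so that the new graph is $(V, (E \setminus \{\overline{xy}\}) \cup \{\overline{xz}\})$. (This is the slide along $\overline{yz}$ with pivot $x$; exchanging the roles of $x$ and $z$ gives the slide along $\overline{xy}$ with pivot $z$, which replaces $\overline{yz}$ by $\overline{xz}$.) A finite sequence of slides may be empty. -}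

module Defs where

open import Data.Bool.Base using (Bool; T)
open import Data.Bool.Properties using (T?)
open import Data.Fin.Base using (Fin)
open import Data.Fin.Properties using (_<?_)
open import Data.List.Base using (List; allFin; cartesianProduct; filter; length)
open import Data.Nat.Base using (ℕ)
open import Data.Product.Base using (_×_; _,_; ∃-syntax)
open import Data.Sum.Base using (_⊎_)
open import Function.Bundles using (_↔_; _⇔_; _⤖_; Inverse; Bijection)
open import Level using (Level)
open import Relation.Binary.Construct.Closure.ReflexiveTransitive using (Star)
open import Relation.Binary.Core using (Rel)
open import Relation.Binary.PropositionalEquality.Core using (_≡_; _≢_)
open import Relation.Nullary.Decidable.Core using (_×-dec_)
open import Relation.Nullary.Negation.Core using (¬_)

private
  variable
    a b : Level

record Finite (V : Set a) : Set a where
  field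
    size : ℕ
    enum : V ↔ Fin size

-- The edge set is given by its characteristic function on pairs of vertices,
-- so adjacency is decidable.  Two graphs with the same edges need not be
-- propositionally equal; `Slide` and `IsIsomorphism` below therefore compare
-- graphs through adjacency only.
record SimpleGraph (V : Set a) : Set a where
  field
    adjacent : V → V → Bool

  infix 4 _~_ _≁_

  _~_ : V → V → Set
  x ~ y = T (adjacent x y)

  _≁_ : V → V → Set
  x ≁ y = ¬ (x ~ y)

  field
    ~-sym    : ∀ {x y} → x ~ y → y ~ x
    ~-irrefl : ∀ {x} → x ≁ x

Connected : {V : Set a} → SimpleGraph V → Set a
Connected Γ = ∀ x y → Star _~_ x y
  where open SimpleGraph Γ

-- |E|: each edge joins exactly one pair of vertices whose positions i and j in
-- the enumeration satisfy i < j, and so is counted once.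
module _ {V : Set a} (fin : Finite V) (Γ : SimpleGraph V) where
  open Finite fin
  open SimpleGraph Γ

  edges : List (Fin size × Fin size)
  edges = filter (λ (i , j) → (i <? j) ×-dec T? (adjacent (from i) (from j)))
                 (cartesianProduct (allFin size) (allFin size))
    where open Inverse enum using (from)

  edgeCount : ℕ
  edgeCount = length edges

-- Equality of the unordered pairs {u , v} and {x , y}.
SamePair : {V : Set a} (u v x y : V) → Set a
SamePair u v x y = (u ≡ x × v ≡ y) ⊎ (u ≡ y × v ≡ x)

-- The edge xy is replaced by xz: E′ = (E ∖ {xy}) ∪ {xz}.
record SlideAt {V : Set a} (Γ Γ′ : SimpleGraph V) (x y z : V) : Set a where
  open SimpleGraph Γ
  open SimpleGraph Γ′ using () renaming (_~_ to _~′_)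
  field
    x≢y : x ≢ y
    y≢z : y ≢ z
    x≢z : x ≢ z
    x~y : x ~ y
    y~z : y ~ z
    x≁z : x ≁ z
    replaced : ∀ u v →
      u ~′ v ⇔ ((u ~ v × ¬ SamePair u v x y) ⊎ SamePair u v x z)

Slide : {V : Set a} → Rel (SimpleGraph V) a
Slide Γ Γ′ = ∃[ x ] ∃[ y ] ∃[ z ] SlideAt Γ Γ′ x y z

IsIsomorphism : {V : Set a} {W : Set b} → SimpleGraph V → SimpleGraph W → V ⤖ W → Set a
IsIsomorphism Γ Σ ψ = ∀ x y → (x ~ᵛ y) ⇔ (to x ~ʷ to y)
  where
  open SimpleGraph Γ using () renaming (_~_ to _~ᵛ_)
  open SimpleGraph Σ using () renaming (_~_ to _~ʷ_)
  open Bijection ψ using (to)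

{-# OPTIONS --safe #-}
-- Slides are reversible, so it suffices to bring Γ and the pullback of Σ along ψ
-- to graphs in which a fixed vertex r is adjacent to every other vertex, and to
-- connect two such graphs.  If r ~ y ~ w and r ≁ w, sliding wy to wr increases
-- the degree of r; such y and w exist as long as r does not dominate the graph.
-- When r dominates, an edge xy avoiding r moves to a non-edge xz avoiding r by
-- first sliding xr to xz and then xy to xr, and two such moves carry any edge ab
-- avoiding r to any non-edge cd avoiding r.  This removes the differences
-- between two dominated graphs one by one: as both have the same number of
-- edges, an edge of the first missing in the second comes with an edge of the
-- second missing in the first.
module Submission where

open import Data.Bool.Base using (T; true; false; if_then_else_)
open import Data.Bool.Properties using (T?)
open import Data.Fin.Base as Fin using (Fin; zero; suc)
import Data.Fin.Properties as Fin
open import Data.List.Base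
  using (List; _++_; map; filter; length; tabulate; allFin; cartesianProduct)
open import Data.List.Properties using (length-++; filter-++; map-tabulate)
open import Data.Nat.Base using (ℕ; zero; suc; _+_; _*_; _≤_; _<_; z≤n)
open import Data.Nat.Induction using (<-wellFounded)
open import Data.Nat.Properties
  using (+-*-semiring; +-mono-≤; +-mono-<-≤; +-mono-≤-<; +-cancelˡ-≡; +-cancelʳ-≡; +-identityʳ;
         ≤-refl; m+n≡0⇒m≡0; m+n≡0⇒n≡0)
open import Algebra.Properties.Semiring.Sum +-*-semiring
  using (sum; sum-cong-≗; sum-replicate-zero; sum-permute; ∑-distrib-+; ∑-comm;
         *-distribˡ-sum; *-distribʳ-sum)
open import Data.Product.Base using (_×_; _,_; proj₁; proj₂; ∃; ∃-syntax; swap)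
open import Data.Sum.Base using (_⊎_; inj₁; inj₂; [_,_])
import Data.Sum.Base as Sum
open import Data.Unit.Base using (⊤; tt)
open import Function.Base using (_∘_; id)
open import Function.Bundles using (_↔_; _⇔_; _⤖_; Inverse; Equivalence; mk⇔)
open import Function.Properties.Bijection using (⤖⇒↔)
open import Function.Properties.Inverse using (↔-sym; ↔-trans; ↔⇒↣)
open import Induction.WellFounded using (Acc; acc)
open import Level using (Level)
open import Relation.Binary.Construct.Closure.ReflexiveTransitive
  using (Star; ε; _◅_; _◅◅_; _⋆; gmap; reverse; fold)
open import Relation.Binary.Definitions using (DecidableEquality; tri<; tri≈; tri>)
open import Relation.Binary.PropositionalEquality.Core
  using (_≡_; _≢_; refl; sym; trans; cong; cong₂; subst; subst₂; ≢-sym)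
open import Relation.Binary.PropositionalEquality.Properties using (module ≡-Reasoning)
open import Relation.Nullary.Decidable
  using (Dec; yes; no; does; isYes; toWitness; fromWitness; map′; does-⇔; via-injection;
         decidable-stable; ¬?; _×-dec_; _⊎-dec_)
open import Relation.Nullary.Negation using (¬_; contradiction)
open import Relation.Unary using (Pred; Decidable)
open import Defs

open Equivalence using (to; from)

private
  variable
    a b p : Level
    A B P Q : Set a
    V : Set a

-- Sums of indicators

⟦_⟧ : Dec A → ℕ
⟦ A? ⟧ = if does A? then 1 else 0

⟦⟧-cong : A ⇔ B → (A? : Dec A) (B? : Dec B) → ⟦ A? ⟧ ≡ ⟦ B? ⟧
⟦⟧-cong A⇔B A? B? = cong (if_then 1 else 0) (does-⇔ A⇔B A? B?)

⟦⟧-mono-≤ : (A → B) → (A? : Dec A) (B? : Dec B) → ⟦ A? ⟧ ≤ ⟦ B? ⟧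
⟦⟧-mono-≤ f (no _)  _       = z≤n
⟦⟧-mono-≤ f (yes _) (yes _) = ≤-refl
⟦⟧-mono-≤ f (yes x) (no ¬y) = contradiction (f x) ¬y

⟦⟧-mono-< : ¬ A → B → (A? : Dec A) (B? : Dec B) → ⟦ A? ⟧ < ⟦ B? ⟧
⟦⟧-mono-< ¬x y (yes x) _       = contradiction x ¬x
⟦⟧-mono-< ¬x y (no _)  (yes _) = ≤-refl
⟦⟧-mono-< ¬x y (no _)  (no ¬y) = contradiction y ¬y

⟦⟧-zero : ¬ A → (A? : Dec A) → ⟦ A? ⟧ ≡ 0
⟦⟧-zero ¬x (yes x) = contradiction x ¬x
⟦⟧-zero ¬x (no _)  = refl

⟦⟧-zero⁻¹ : (A? : Dec A) → ⟦ A? ⟧ ≡ 0 → ¬ A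
⟦⟧-zero⁻¹ (no ¬x) _ = ¬x

⟦⟧-split : (A? : Dec A) (B? : Dec B) → ⟦ A? ⟧ ≡ ⟦ A? ×-dec B? ⟧ + ⟦ A? ×-dec ¬? B? ⟧
⟦⟧-split (no _)  _       = refl
⟦⟧-split (yes _) (yes _) = refl
⟦⟧-split (yes _) (no _)  = refl

-- Taking `P` out of `A` and putting `Q` in is balanced additively, which avoids subtraction in ℕ.
-- Summed over all pairs of vertices, this compares the edges before and after a slide.
⟦⟧-exchange : (P → A) → (Q → ¬ A) → (A? : Dec A) (P? : Dec P) (Q? : Dec Q) →
              ⟦ (A? ×-dec ¬? P?) ⊎-dec Q? ⟧ + ⟦ P? ⟧ ≡ ⟦ A? ⟧ + ⟦ Q? ⟧
⟦⟧-exchange P⇒A Q⇒¬A (yes x) _       (yes q) = contradiction x (Q⇒¬A q)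
⟦⟧-exchange P⇒A Q⇒¬A (yes _) (yes _) (no _)  = refl
⟦⟧-exchange P⇒A Q⇒¬A (yes _) (no _)  (no _)  = refl
⟦⟧-exchange P⇒A Q⇒¬A (no ¬x) (yes p) _       = contradiction (P⇒A p) ¬x
⟦⟧-exchange P⇒A Q⇒¬A (no _)  (no _)  (yes _) = refl
⟦⟧-exchange P⇒A Q⇒¬A (no _)  (no _)  (no _)  = refl

-- Products are used so that a double sum over `u` and `v` factors into two single sums.
⟦⟧-disjoint : ¬ (A × P) → (A? : Dec A) (B? : Dec B) (P? : Dec P) (Q? : Dec Q) →
              ⟦ (A? ×-dec B?) ⊎-dec (P? ×-dec Q?) ⟧ ≡ ⟦ A? ⟧ * ⟦ B? ⟧ + ⟦ P? ⟧ * ⟦ Q? ⟧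
⟦⟧-disjoint ¬AP (yes x) _       (yes p) _       = contradiction (x , p) ¬AP
⟦⟧-disjoint ¬AP (yes _) (yes _) (no _)  _       = refl
⟦⟧-disjoint ¬AP (yes _) (no _)  (no _)  _       = refl
⟦⟧-disjoint ¬AP (no _)  _       (yes _) (yes _) = refl
⟦⟧-disjoint ¬AP (no _)  _       (yes _) (no _)  = refl
⟦⟧-disjoint ¬AP (no _)  _       (no _)  _       = refl

sum-mono-≤ : ∀ {n} {f g : Fin n → ℕ} → (∀ i → f i ≤ g i) → sum f ≤ sum g
sum-mono-≤ {zero}  f≤g = z≤n
sum-mono-≤ {suc n} f≤g = +-mono-≤ (f≤g zero) (sum-mono-≤ (f≤g ∘ suc))

sum-mono-< : ∀ {n} {f g : Fin n → ℕ} → (∀ i → f i ≤ g i) → ∀ k → f k < g k → sum f < sum g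
sum-mono-< f≤g zero    f<g = +-mono-<-≤ f<g (sum-mono-≤ (f≤g ∘ suc))
sum-mono-< f≤g (suc k) f<g = +-mono-≤-< (f≤g zero) (sum-mono-< (f≤g ∘ suc) k f<g)

sum-zero : ∀ {n} {f : Fin n → ℕ} → (∀ i → f i ≡ 0) → sum f ≡ 0
sum-zero {n} f≡0 = trans (sum-cong-≗ f≡0) (sum-replicate-zero n)

sum-zero⁻¹ : ∀ {n} {f : Fin n → ℕ} → sum f ≡ 0 → ∀ i → f i ≡ 0
sum-zero⁻¹ {f = f} eq zero    = m+n≡0⇒m≡0 (f zero) eq
sum-zero⁻¹ {f = f} eq (suc i) = sum-zero⁻¹ (m+n≡0⇒n≡0 (f zero) eq) i

sum-singleton : ∀ {n} (k : Fin n) → sum (λ i → ⟦ i Fin.≟ k ⟧) ≡ 1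
sum-singleton {suc n} zero    = cong suc (sum-zero {n} λ _ → refl)
sum-singleton {suc n} (suc k) = sum-singleton k

-- Lengths of filtered lists as sums of indicators

module _ {P : Pred A p} (P? : Decidable P) where

  length-filter-tabulate : ∀ {n} (f : Fin n → A) →
    length (filter P? (tabulate f)) ≡ sum (λ i → ⟦ P? (f i) ⟧)
  length-filter-tabulate {zero}  f = refl
  length-filter-tabulate {suc n} f with does (P? (f zero))
  ... | true  = cong suc (length-filter-tabulate (f ∘ suc))
  ... | false = length-filter-tabulate (f ∘ suc)

length-filter-cartesianProduct : ∀ {P : Pred (A × B) p} (P? : Decidable P)
  {m} (f : Fin m → A) (ys : List B) →
  length (filter P? (cartesianProduct (tabulate f) ys)) ≡
  sum (λ i → length (filter P? (map (f i ,_) ys)))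
length-filter-cartesianProduct P? {zero}  f ys = refl
length-filter-cartesianProduct P? {suc m} f ys = begin
  length (filter P? (map (f zero ,_) ys ++ rest))
    ≡⟨ cong length (filter-++ P? (map (f zero ,_) ys) rest) ⟩
  length (filter P? (map (f zero ,_) ys) ++ filter P? rest)
    ≡⟨ length-++ (filter P? (map (f zero ,_) ys)) ⟩
  length (filter P? (map (f zero ,_) ys)) + length (filter P? rest)
    ≡⟨ cong (length (filter P? (map (f zero ,_) ys)) +_)
            (length-filter-cartesianProduct P? (f ∘ suc) ys) ⟩
  sum (λ i → length (filter P? (map (f i ,_) ys))) ∎
  where
  open ≡-Reasoning
  rest = cartesianProduct (tabulate (f ∘ suc)) ys

length-filter-pairs : ∀ {n} {P : Pred (Fin n × Fin n) p} (P? : Decidable P) →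
  length (filter P? (cartesianProduct (allFin n) (allFin n))) ≡
  sum (λ i → sum (λ j → ⟦ P? (i , j) ⟧))
length-filter-pairs {n = n} P? = trans
  (length-filter-cartesianProduct P? id (allFin n))
  (sum-cong-≗ λ i → trans
    (cong (length ∘ filter P?) (map-tabulate id (i ,_)))
    (length-filter-tabulate P? (i ,_)))

-- Replacing edges

SamePair-swapˡ : {u v x y : V} → SamePair u v x y → SamePair v u x y
SamePair-swapˡ = Sum.swap ∘ Sum.map swap swap

SamePair-swapʳ : {u v x y : V} → SamePair u v x y → SamePair u v y x
SamePair-swapʳ = Sum.swap

SamePair-unique : {u v x y z w : V} → SamePair u v x y → SamePair u v z w → SamePair x y z w
SamePair-unique (inj₁ (refl , refl)) q = q
SamePair-unique (inj₂ (refl , refl)) q = SamePair-swapˡ q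

infix 4 _≈_
_≈_ : SimpleGraph V → SimpleGraph V → Set _
Γ ≈ Δ = ∀ u v → (u ~₁ v) ⇔ (u ~₂ v)
  where
  open SimpleGraph Γ using () renaming (_~_ to _~₁_)
  open SimpleGraph Δ using () renaming (_~_ to _~₂_)

-- The change of edges in `SlideAt`, but with two arbitrary pairs, so that it also describes the net
-- effect of several slides.
record Replaces {V : Set a} (Γ Γ′ : SimpleGraph V) (x y z w : V) : Set a where
  constructor mkReplaces
  open SimpleGraph Γ
  open SimpleGraph Γ′ using () renaming (_~_ to _~′_; _≁_ to _≁′_)
  field
    replaces : ∀ u v → u ~′ v ⇔ ((u ~ v × ¬ SamePair u v x y) ⊎ SamePair u v z w)

  kept : ∀ {u v} → u ~ v → ¬ SamePair u v x y → u ~′ v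
  kept u~v ≢xy = from (replaces _ _) (inj₁ (u~v , ≢xy))

  added : z ~′ w
  added = from (replaces _ _) (inj₂ (inj₁ (refl , refl)))

  old : ∀ {u v} → u ~′ v → ¬ SamePair u v z w → u ~ v
  old u~′v ≢zw with to (replaces _ _) u~′v
  ... | inj₁ (u~v , _) = u~v
  ... | inj₂ ≡zw       = contradiction ≡zw ≢zw

  removed : ¬ SamePair x y z w → x ≁′ y
  removed ≢zw x~′y with to (replaces _ _) x~′y
  ... | inj₁ (_ , ≢xy) = ≢xy (inj₁ (refl , refl))
  ... | inj₂ ≡zw       = ≢zw ≡zw

Replaces-swapˡ : ∀ {Γ Γ′ : SimpleGraph V} {x y z w} → Replaces Γ Γ′ x y z w → Replaces Γ Γ′ y x z w
Replaces-swapˡ (mkReplaces R) = mkReplaces λ u v → mk⇔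
  (Sum.map₁ (λ (u~v , ≢xy) → u~v , ≢xy ∘ SamePair-swapʳ) ∘ to (R u v))
  (from (R u v) ∘ Sum.map₁ (λ (u~v , ≢yx) → u~v , ≢yx ∘ SamePair-swapʳ))

Replaces-swapʳ : ∀ {Γ Γ′ : SimpleGraph V} {x y z w} → Replaces Γ Γ′ x y z w → Replaces Γ Γ′ x y w z
Replaces-swapʳ (mkReplaces R) = mkReplaces λ u v → mk⇔
  (Sum.map₂ SamePair-swapʳ ∘ to (R u v))
  (from (R u v) ∘ Sum.map₂ SamePair-swapʳ)

module _ (Γ : SimpleGraph V) where
  open SimpleGraph Γ

  SamePair-~ : ∀ {u v x y} → x ~ y → SamePair u v x y → u ~ v
  SamePair-~ x~y (inj₁ (refl , refl)) = x~y
  SamePair-~ x~y (inj₂ (refl , refl)) = ~-sym x~y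

  SamePair-≁ : ∀ {u v x y} → x ≁ y → SamePair u v x y → u ≁ v
  SamePair-≁ x≁y (inj₁ (refl , refl)) = x≁y
  SamePair-≁ x≁y (inj₂ (refl , refl)) = x≁y ∘ ~-sym

  ~⇒≢ : ∀ {x y} → x ~ y → x ≢ y
  ~⇒≢ x~x refl = ~-irrefl x~x

-- Reversibility of slides and preservation of connectedness

SlideAt⇒Replaces : ∀ {Γ Γ′ : SimpleGraph V} {x y z} → SlideAt Γ Γ′ x y z → Replaces Γ Γ′ x y x z
SlideAt⇒Replaces s = mkReplaces (SlideAt.replaced s)

Slide-respˡ-≈ : {Γ Γ₁ Γ₂ : SimpleGraph V} → Γ ≈ Γ₁ → Slide Γ₁ Γ₂ → Slide Γ Γ₂
Slide-respˡ-≈ Γ≈Γ₁ (x , y , z , s) = x , y , z , record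
  { x≢y = x≢y
  ; y≢z = y≢z
  ; x≢z = x≢z
  ; x~y = from (Γ≈Γ₁ _ _) x~y
  ; y~z = from (Γ≈Γ₁ _ _) y~z
  ; x≁z = x≁z ∘ to (Γ≈Γ₁ _ _)
  ; replaced = λ u v → mk⇔
      (Sum.map₁ (λ (u~v , ≢) → from (Γ≈Γ₁ u v) u~v , ≢) ∘ to (replaced u v))
      (from (replaced u v) ∘ Sum.map₁ (λ (u~v , ≢) → to (Γ≈Γ₁ u v) u~v , ≢))
  }
  where open SlideAt s

-- The first slide absorbs the change of source and the rest is untouched. The target is weakened to
-- `≈` for the empty sequence, which must end at `Γ` itself.
Slides-respˡ-≈ : {Γ Γ₁ Γ₂ : SimpleGraph V} → Γ ≈ Γ₁ → Star Slide Γ₁ Γ₂ →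
                 ∃[ Γ′ ] (Star Slide Γ Γ′ × Γ′ ≈ Γ₂)
Slides-respˡ-≈ {Γ = Γ} Γ≈Γ₁ ε = Γ , ε , Γ≈Γ₁
Slides-respˡ-≈ {Γ₂ = Γ₂} Γ≈Γ₁ (s ◅ ss) =
  Γ₂ , Slide-respˡ-≈ Γ≈Γ₁ s ◅ ss , λ _ _ → mk⇔ id id

module _ {V : Set a} (_≟_ : DecidableEquality V) where

  samePair? : (u v x y : V) → Dec (SamePair u v x y)
  samePair? u v x y = (u ≟ x ×-dec v ≟ y) ⊎-dec (u ≟ y ×-dec v ≟ x)

  -- The edge `xz` slides back along `zy` with the same pivot `x`: `yz` was kept and `xy` is now
  -- vacant.
  Slide-sym : {Γ Γ′ : SimpleGraph V} → Slide Γ Γ′ → Slide Γ′ Γ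
  Slide-sym {Γ} {Γ′} (x , y , z , s) = x , z , y , record
    { x≢y = x≢z
    ; y≢z = ≢-sym y≢z
    ; x≢z = x≢y
    ; x~y = added
    ; y~z = kept (~-sym y~z) [ ≢-sym x≢z ∘ proj₁ , ≢-sym y≢z ∘ proj₁ ]
    ; x≁z = removed [ y≢z ∘ proj₂ , x≢z ∘ proj₁ ]
    ; replaced = λ u v → mk⇔ (unreplace u v)
        [ (λ (u~′v , ≢xz) → old u~′v ≢xz) , SamePair-~ Γ x~y ]
    }
    where
    open SlideAt s
    open Replaces (SlideAt⇒Replaces s)
    open SimpleGraph Γ
    open SimpleGraph Γ′ using () renaming (_~_ to _~′_)

    unreplace : ∀ u v → u ~ v → (u ~′ v × ¬ SamePair u v x z) ⊎ SamePair u v x y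
    unreplace u v u~v with samePair? u v x y
    ... | yes ≡xy = inj₂ ≡xy
    ... | no  ≢xy = inj₁ (kept u~v ≢xy , λ ≡xz → SamePair-≁ Γ x≁z ≡xz u~v)

  -- Only `xy` is lost, and in `Γ′` the path from `x` through `z` to `y` replaces it.
  Slide-connected : {Γ Γ′ : SimpleGraph V} → Slide Γ Γ′ → Connected Γ → Connected Γ′
  Slide-connected {Γ} {Γ′} (x , y , z , s) conn u v = (detour ⋆) (conn u v)
    where
    open SlideAt s
    open Replaces (SlideAt⇒Replaces s)
    open SimpleGraph Γ
    open SimpleGraph Γ′ using () renaming (_~_ to _~′_; ~-sym to ~′-sym)

    y~′z : y ~′ z
    y~′z = kept y~z [ ≢-sym x≢y ∘ proj₁ , ≢-sym x≢z ∘ proj₂ ]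

    detour : ∀ {u v} → u ~ v → Star _~′_ u v
    detour {u} {v} u~v with samePair? u v x y
    ... | no  ≢xy                  = kept u~v ≢xy ◅ ε
    ... | yes (inj₁ (refl , refl)) = added ◅ ~′-sym y~′z ◅ ε
    ... | yes (inj₂ (refl , refl)) = y~′z ◅ ~′-sym added ◅ ε

  replaceEdge : (Γ : SimpleGraph V) (x y z w : V) → z ≢ w → SimpleGraph V
  replaceEdge Γ x y z w z≢w = record
    { adjacent = λ u v → isYes (edge? u v)
    ; ~-sym    = λ {u} {v} → fromWitness ∘ edge-sym ∘ toWitness {a? = edge? u v}
    ; ~-irrefl = λ {u} → edge-irrefl ∘ toWitness {a? = edge? u u}
    }
    where
    open SimpleGraph Γ

    Edge : V → V → Set _
    Edge u v = (u ~ v × ¬ SamePair u v x y) ⊎ SamePair u v z w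

    edge? : ∀ u v → Dec (Edge u v)
    edge? u v = (T? _ ×-dec ¬? (samePair? u v x y)) ⊎-dec samePair? u v z w

    edge-sym : ∀ {u v} → Edge u v → Edge v u
    edge-sym = Sum.map (λ (u~v , ≢) → ~-sym u~v , ≢ ∘ SamePair-swapˡ) SamePair-swapˡ

    edge-irrefl : ∀ {u} → ¬ Edge u u
    edge-irrefl (inj₁ (u~u , _))             = ~-irrefl u~u
    edge-irrefl (inj₂ (inj₁ (refl , refl))) = z≢w refl
    edge-irrefl (inj₂ (inj₂ (refl , refl))) = z≢w refl

  replaceEdge-replaces : ∀ Γ {x y z w} (z≢w : z ≢ w) →
                         Replaces Γ (replaceEdge Γ x y z w z≢w) x y z w
  replaceEdge-replaces Γ _ = mkReplaces λ u v → mk⇔ toWitness fromWitness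

  -- Composition of moves

  Moves : SimpleGraph V → (x y z w : V) → Set _
  Moves Γ x y z w = ∃[ Γ′ ] (Star Slide Γ Γ′ × Replaces Γ Γ′ x y z w)

  Moves-swapˡ : ∀ {Γ x y z w} → Moves Γ x y z w → Moves Γ y x z w
  Moves-swapˡ (Γ′ , ss , R) = Γ′ , ss , Replaces-swapˡ R

  Moves-swapʳ : ∀ {Γ x y z w} → Moves Γ x y z w → Moves Γ x y w z
  Moves-swapʳ (Γ′ , ss , R) = Γ′ , ss , Replaces-swapʳ R

  module _ (Γ : SimpleGraph V) where
    open SimpleGraph Γ

    slide : ∀ {x y z} → x ~ y → y ~ z → x ≁ z → x ≢ z → Moves Γ x y x z
    slide {x} {y} {z} x~y y~z x≁z x≢z = _ , (x , y , z , s) ◅ ε , SlideAt⇒Replaces s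
      where
      s : SlideAt Γ (replaceEdge Γ x y x z x≢z) x y z
      s = record
        { x≢y = ~⇒≢ Γ x~y
        ; y≢z = ~⇒≢ Γ y~z
        ; x≢z = x≢z
        ; x~y = x~y
        ; y~z = y~z
        ; x≁z = x≁z
        ; replaced = Replaces.replaces (replaceEdge-replaces Γ x≢z)
        }

    -- The edge xy travels to zw through the vacant position mn.
    through-vacant : ∀ {x y m n z w} → m ≁ n →
      ((Γ′ , _) : Moves Γ x y m n) → Moves Γ′ m n z w → Moves Γ x y z w
    through-vacant {x} {y} {m} {n} {z} {w} m≁n (Γ′ , ss , mkReplaces R) (Γ″ , ss′ , mkReplaces R′) =
      Γ″ , ss ◅◅ ss′ , mkReplaces λ u v → mk⇔ (⇒ u v) (⇐ u v)
      where
      open SimpleGraph Γ″ using () renaming (_~_ to _~″_)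

      ⇒ : ∀ u v → u ~″ v → (u ~ v × ¬ SamePair u v x y) ⊎ SamePair u v z w
      ⇒ u v u~″v with to (R′ u v) u~″v
      ... | inj₂ ≡zw = inj₂ ≡zw
      ... | inj₁ (u~′v , ≢mn) with to (R u v) u~′v
      ...   | inj₁ old = inj₁ old
      ...   | inj₂ ≡mn = contradiction ≡mn ≢mn

      ⇐ : ∀ u v → (u ~ v × ¬ SamePair u v x y) ⊎ SamePair u v z w → u ~″ v
      ⇐ u v (inj₂ ≡zw) = from (R′ u v) (inj₂ ≡zw)
      ⇐ u v (inj₁ old) = from (R′ u v)
        (inj₁ (from (R u v) (inj₁ old) , λ ≡mn → SamePair-≁ Γ m≁n ≡mn (proj₁ old)))

    -- The edge mn moves on to zw and the edge xy takes its place.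
    through-edge : ∀ {x y m n z w} → x ~ y → m ~ n → z ≁ w → ¬ SamePair m n x y →
      ((Γ′ , _) : Moves Γ m n z w) → Moves Γ′ x y m n → Moves Γ x y z w
    through-edge {x} {y} {m} {n} {z} {w} x~y m~n z≁w mn≢xy (Γ′ , ss , mkReplaces R) (Γ″ , ss′ , mkReplaces R′) =
      Γ″ , ss ◅◅ ss′ , mkReplaces λ u v → mk⇔ (⇒ u v) (⇐ u v)
      where
      open SimpleGraph Γ″ using () renaming (_~_ to _~″_)

      ⇒ : ∀ u v → u ~″ v → (u ~ v × ¬ SamePair u v x y) ⊎ SamePair u v z w
      ⇒ u v u~″v with to (R′ u v) u~″v
      -- The refilled `mn` was already an edge of `Γ`, and it is not the edge that was to go.
      ... | inj₂ ≡mn = inj₁ (SamePair-~ Γ m~n ≡mn , mn≢xy ∘ SamePair-unique ≡mn)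
      ... | inj₁ (u~′v , ≢xy) with to (R u v) u~′v
      ...   | inj₁ (u~v , _) = inj₁ (u~v , ≢xy)
      ...   | inj₂ ≡zw       = inj₂ ≡zw

      ⇐ : ∀ u v → (u ~ v × ¬ SamePair u v x y) ⊎ SamePair u v z w → u ~″ v
      -- The newly placed `zw` survives the second move, which removes `xy`: one is a non-edge of
      -- `Γ`, the other an edge.
      ⇐ u v (inj₂ ≡zw) = from (R′ u v) (inj₁ (from (R u v) (inj₂ ≡zw) ,
        λ ≡xy → SamePair-≁ Γ z≁w ≡zw (SamePair-~ Γ x~y ≡xy)))
      ⇐ u v (inj₁ (u~v , ≢xy)) with samePair? u v m n
      ... | yes ≡mn = from (R′ u v) (inj₂ ≡mn)
      ... | no  ≢mn = from (R′ u v) (inj₁ (from (R u v) (inj₁ (u~v , ≢mn)) , ≢xy))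

  -- Moving edges in a dominated graph

  Dominates : V → SimpleGraph V → Set _
  Dominates r Γ = ∀ v → v ≢ r → r ~ v
    where open SimpleGraph Γ

  module _ {r : V} where

    Replaces-dominates : ∀ {Γ Γ′ x y z w} → x ≢ r → y ≢ r → Replaces Γ Γ′ x y z w →
                         Dominates r Γ → Dominates r Γ′
    Replaces-dominates x≢r y≢r R dom v v≢r =
      kept (dom v v≢r) [ ≢-sym x≢r ∘ proj₁ , ≢-sym y≢r ∘ proj₁ ]
      where open Replaces R

    -- As `y ~ z` is not assumed, a direct slide may be impossible. The vertex `r` is adjacent to
    -- both `y` and `z` and stands in: `xr` goes to `xz` along `rz`, then `xy` takes the place of
    -- `xr` along `yr`, which restores domination.
    pivot : ∀ Γ → Dominates r Γ → (let open SimpleGraph Γ) → ∀ {x y z} →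
            x ≢ r → y ≢ r → z ≢ r → x ≢ z → x ~ y → x ≁ z → Moves Γ x y x z
    pivot Γ dom {x} {y} {z} x≢r y≢r z≢r x≢z x~y x≁z =
      through-edge Γ x~y x~r x≁z [ ≢-sym y≢r ∘ proj₂ , ≢-sym x≢r ∘ proj₂ ] xr→xz
        (slide Γ′
          (kept x~y [ y≢r ∘ proj₂ , x≢r ∘ proj₁ ])
          (kept (~-sym (dom y y≢r)) [ ≢-sym (~⇒≢ Γ x~y) ∘ proj₁ , y≢r ∘ proj₁ ])
          (removed [ ≢-sym z≢r ∘ proj₂ , x≢z ∘ proj₁ ])
          x≢r)
      where
      open SimpleGraph Γ
      x~r = ~-sym (dom x x≢r)
      xr→xz = slide Γ x~r (dom z z≢r) x≁z x≢z
      Γ′ = proj₁ xr→xz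
      open Replaces (proj₂ (proj₂ xr→xz))

    -- The pair `xz` meets both `xy` and `zw` and serves as the intermediate position. If it is
    -- vacant, the edge moves there and then on to `zw`; if it is occupied, its edge moves to `zw`
    -- first and `xy` follows into the gap. For `x ≡ z` one pivot is enough.
    move : ∀ Γ → Dominates r Γ → (let open SimpleGraph Γ) → ∀ {x y z w} →
           x ≢ r → y ≢ r → z ≢ r → w ≢ r → z ≢ w → x ~ y → z ≁ w → Moves Γ x y z w
    move Γ dom {x} {y} {z} {w} x≢r y≢r z≢r w≢r z≢w x~y z≁w = go (x ≟ z) (T? _)
      where
      open SimpleGraph Γ

      via-xz : x ≢ z → x ≁ z → Moves Γ x y z w
      via-xz x≢z x≁z with w ≟ x
      -- The intermediate position is already the target.
      ... | yes refl = Moves-swapʳ (pivot Γ dom x≢r y≢r z≢r x≢z x~y x≁z)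
      ... | no  w≢x  = through-vacant Γ x≁z xy→xz (Moves-swapˡ
        (pivot Γ′ (Replaces-dominates x≢r y≢r R dom) z≢r x≢r w≢r z≢w (~′-sym added)
          λ z~′w → z≁w (old z~′w [ ≢-sym x≢z ∘ proj₁ , w≢x ∘ proj₂ ])))
        where
        xy→xz = pivot Γ dom x≢r y≢r z≢r x≢z x~y x≁z
        Γ′ = proj₁ xy→xz
        R = proj₂ (proj₂ xy→xz)
        open Replaces R
        open SimpleGraph Γ′ using () renaming (~-sym to ~′-sym)

      displacing-xz : x ≢ z → x ~ z → Moves Γ x y z w
      displacing-xz x≢z x~z with y ≟ z
      -- The edge to be moved is `xz` itself, so nothing has to follow it.
      ... | yes refl = Moves-swapˡ (pivot Γ dom z≢r x≢r w≢r z≢w (~-sym x~z) z≁w)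
      ... | no  y≢z  = through-edge Γ x~y x~z z≁w
        [ ≢-sym y≢z ∘ proj₂ , ~⇒≢ Γ x~y ∘ proj₁ ] xz→zw
        (pivot Γ′ (Replaces-dominates x≢r z≢r R dom) x≢r y≢r z≢r x≢z
          (kept x~y [ y≢z ∘ proj₂ , x≢z ∘ proj₁ ])
          -- The position `xz` is really vacated: `zw` is a different pair, since `w ≡ x` would make
          -- it an edge of `Γ`.
          (removed [ x≢z ∘ proj₁ , (λ { (refl , _) → z≁w (~-sym x~z) }) ]))
        where
        xz→zw = Moves-swapˡ (pivot Γ dom z≢r x≢r w≢r z≢w (~-sym x~z) z≁w)
        Γ′ = proj₁ xz→zw
        R = proj₂ (proj₂ xz→zw)
        open Replaces R

      go : Dec (x ≡ z) → Dec (x ~ z) → Moves Γ x y z w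
      go (yes refl) _         = pivot Γ dom x≢r y≢r w≢r z≢w x~y z≁w
      go (no x≢z)   (no x≁z)  = via-xz x≢z x≁z
      go (no x≢z)   (yes x~z) = displacing-xz x≢z x~z

-- Counting edges

module _ {V : Set a} (fin : Finite V) where
  open Finite fin
  open Inverse enum using () renaming (to to index; from to vertex; strictlyInverseʳ to vertex-index)

  _≟_ : DecidableEquality V
  _≟_ = via-injection (↔⇒↣ enum) Fin._≟_

  search : {P : Pred V p} → Decidable P → Dec (∃ P)
  search {P = P} P? = map′
    (λ (i , px) → vertex i , px)
    (λ (x , px) → index x , subst P (sym (vertex-index x)) px)
    (Fin.any? (P? ∘ vertex))

  ∑ : (V → ℕ) → ℕ
  ∑ f = sum (f ∘ vertex)

  ∑-mono-< : ∀ {f g} → (∀ x → f x ≤ g x) → ∀ y → f y < g y → ∑ f < ∑ g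
  ∑-mono-< {f} {g} f≤g y fy<gy = sum-mono-< (f≤g ∘ vertex) (index y)
    (subst (λ x → f x < g x) (sym (vertex-index y)) fy<gy)

  ∑-zero⁻¹ : ∀ {f} → ∑ f ≡ 0 → ∀ x → f x ≡ 0
  ∑-zero⁻¹ {f} eq x = subst (λ y → f y ≡ 0) (vertex-index x) (sum-zero⁻¹ eq (index x))

  ∑-singleton : ∀ x → ∑ (λ u → ⟦ u ≟ x ⟧) ≡ 1
  ∑-singleton x = trans
    (sum-cong-≗ λ i → ⟦⟧-cong
      (mk⇔ (λ { refl → sym (strictlyInverseˡ i) }) (λ { refl → vertex-index x }))
      (vertex i ≟ x) (i Fin.≟ index x))
    (sum-singleton (index x))
    where open Inverse enum using (strictlyInverseˡ)

  ∑² : (V → V → ℕ) → ℕ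
  ∑² f = ∑ (λ u → ∑ (f u))

  ∑²-cong : ∀ {f g} → (∀ u v → f u v ≡ g u v) → ∑² f ≡ ∑² g
  ∑²-cong f≗g = sum-cong-≗ λ i → sum-cong-≗ λ j → f≗g (vertex i) (vertex j)

  ∑²-+ : ∀ f g → ∑² (λ u v → f u v + g u v) ≡ ∑² f + ∑² g
  ∑²-+ f g = trans
    (sum-cong-≗ λ i → ∑-distrib-+ (f (vertex i) ∘ vertex) (g (vertex i) ∘ vertex))
    (∑-distrib-+ (λ i → ∑ (f (vertex i))) (λ i → ∑ (g (vertex i))))

  ∑²-* : ∀ f g → ∑² (λ u v → f u * g v) ≡ ∑ f * ∑ g
  ∑²-* f g = sym (trans
    (*-distribʳ-sum (∑ g) (f ∘ vertex))
    (sum-cong-≗ λ i → *-distribˡ-sum (f (vertex i)) (g ∘ vertex)))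

  ∑²-mono-< : ∀ {f g} → (∀ u v → f u v ≤ g u v) → ∀ x y → f x y < g x y → ∑² f < ∑² g
  ∑²-mono-< f≤g x y f<g =
    ∑-mono-< (λ u → sum-mono-≤ (f≤g u ∘ vertex)) x (∑-mono-< (f≤g x) y f<g)

  ∑²-zero : ∀ {f} → (∀ u v → f u v ≡ 0) → ∑² f ≡ 0
  ∑²-zero f≡0 = sum-zero λ i → sum-zero λ j → f≡0 (vertex i) (vertex j)

  ∑²-zero⁻¹ : ∀ {f} → ∑² f ≡ 0 → ∀ u v → f u v ≡ 0
  ∑²-zero⁻¹ eq u = ∑-zero⁻¹ (∑-zero⁻¹ eq u)

  -- The pair is met once in each order, and the two orders are distinct because `x ≢ y`.
  ∑²-samePair : ∀ {x y} → x ≢ y → ∑² (λ u v → ⟦ samePair? _≟_ u v x y ⟧) ≡ 2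
  ∑²-samePair {x} {y} x≢y = begin
    ∑² (λ u v → ⟦ samePair? _≟_ u v x y ⟧)
      ≡⟨ ∑²-cong pointwise ⟩
    ∑² (λ u v → ⟦ u ≟ x ⟧ * ⟦ v ≟ y ⟧ + ⟦ u ≟ y ⟧ * ⟦ v ≟ x ⟧)
      ≡⟨ ∑²-+ (λ u v → ⟦ u ≟ x ⟧ * ⟦ v ≟ y ⟧) (λ u v → ⟦ u ≟ y ⟧ * ⟦ v ≟ x ⟧) ⟩
    ∑² (λ u v → ⟦ u ≟ x ⟧ * ⟦ v ≟ y ⟧) + ∑² (λ u v → ⟦ u ≟ y ⟧ * ⟦ v ≟ x ⟧)
      ≡⟨ cong₂ _+_ (product x y) (product y x) ⟩
    2 ∎
    where
    open ≡-Reasoning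

    product : ∀ x y → ∑² (λ u v → ⟦ u ≟ x ⟧ * ⟦ v ≟ y ⟧) ≡ 1
    product x y = trans (∑²-* (λ u → ⟦ u ≟ x ⟧) (λ v → ⟦ v ≟ y ⟧))
      (cong₂ _*_ (∑-singleton x) (∑-singleton y))

    pointwise : ∀ u v → ⟦ samePair? _≟_ u v x y ⟧ ≡
                        ⟦ u ≟ x ⟧ * ⟦ v ≟ y ⟧ + ⟦ u ≟ y ⟧ * ⟦ v ≟ x ⟧
    pointwise u v = ⟦⟧-disjoint (λ (u≡x , u≡y) → x≢y (trans (sym u≡x) u≡y))
      (u ≟ x) (v ≟ y) (u ≟ y) (v ≟ x)

  -- Running over ordered pairs, this makes no reference to the order of the enumeration, unlike
  -- `edgeCount`, and is therefore easier to follow through slides and bijections.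
  degreeSum : SimpleGraph V → ℕ
  degreeSum Γ = ∑² λ u v → ⟦ T? (adjacent u v) ⟧
    where open SimpleGraph Γ

  -- Off the diagonal exactly one of `i < j` and `j < i` holds, and the diagonal contributes nothing
  -- by irreflexivity. Interchanging the two summations turns the half with `j < i` into the half
  -- with `i < j`.
  handshake : ∀ Γ → degreeSum Γ ≡ edgeCount fin Γ + edgeCount fin Γ
  handshake Γ = begin
    degreeSum Γ
      ≡⟨ (sum-cong-≗ λ i → sum-cong-≗ λ j → orient i j) ⟩
    sum (λ i → sum λ j → ⟦ up? i j ⟧ + ⟦ up? j i ⟧)
      ≡⟨ (sum-cong-≗ λ i → ∑-distrib-+ (λ j → ⟦ up? i j ⟧) (λ j → ⟦ up? j i ⟧)) ⟩
    sum (λ i → sum (λ j → ⟦ up? i j ⟧) + sum (λ j → ⟦ up? j i ⟧))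
      ≡⟨ ∑-distrib-+ (λ i → sum λ j → ⟦ up? i j ⟧) (λ i → sum λ j → ⟦ up? j i ⟧) ⟩
    sum (λ i → sum λ j → ⟦ up? i j ⟧) + sum (λ i → sum λ j → ⟦ up? j i ⟧)
      ≡⟨ cong (sum (λ i → sum λ j → ⟦ up? i j ⟧) +_) (∑-comm (λ i j → ⟦ up? j i ⟧)) ⟩
    sum (λ i → sum λ j → ⟦ up? i j ⟧) + sum (λ i → sum λ j → ⟦ up? i j ⟧)
      ≡⟨ cong₂ _+_ (sym edges≡) (sym edges≡) ⟩
    edgeCount fin Γ + edgeCount fin Γ ∎
    where
    open ≡-Reasoning
    open SimpleGraph Γ

    up? : ∀ i j → Dec (i Fin.< j × vertex i ~ vertex j)
    up? i j = (i Fin.<? j) ×-dec T? (adjacent (vertex i) (vertex j))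

    edges≡ : edgeCount fin Γ ≡ sum (λ i → sum λ j → ⟦ up? i j ⟧)
    edges≡ = length-filter-pairs (λ (i , j) → up? i j)

    orient : ∀ i j → ⟦ T? (adjacent (vertex i) (vertex j)) ⟧ ≡ ⟦ up? i j ⟧ + ⟦ up? j i ⟧
    orient i j with Fin.<-cmp i j
    ... | tri< i<j _ j≮i = sym (trans
      (cong₂ _+_ (⟦⟧-cong (mk⇔ proj₂ (i<j ,_)) (up? i j) (T? _))
                 (⟦⟧-zero (j≮i ∘ proj₁) (up? j i)))
      (+-identityʳ _))
    ... | tri≈ _ refl _  = trans (⟦⟧-zero ~-irrefl (T? _)) (sym
      (cong₂ _+_ (⟦⟧-zero (~-irrefl ∘ proj₂) (up? i i)) (⟦⟧-zero (~-irrefl ∘ proj₂) (up? i i))))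
    ... | tri> i≮j _ j<i = sym
      (cong₂ _+_ (⟦⟧-zero (i≮j ∘ proj₁) (up? i j))
                 (⟦⟧-cong (mk⇔ (~-sym ∘ proj₂) (λ i~j → j<i , ~-sym i~j)) (up? j i) (T? _)))

  -- The lost pair `xy` and the gained pair `xz` each contribute 2. They are added on opposite sides
  -- and the 2 is cancelled.
  Slide-degreeSum : ∀ {Γ Γ′} → Slide Γ Γ′ → degreeSum Γ ≡ degreeSum Γ′
  Slide-degreeSum {Γ} {Γ′} (x , y , z , s) = +-cancelʳ-≡ 2 _ _ (begin
    degreeSum Γ + 2
      ≡⟨ cong (degreeSum Γ +_) (∑²-samePair x≢z) ⟨
    degreeSum Γ + ∑² (λ u v → ⟦ samePair? _≟_ u v x z ⟧)
      ≡⟨ ∑²-+ (λ u v → ⟦ T? (adjacent u v) ⟧) (λ u v → ⟦ samePair? _≟_ u v x z ⟧) ⟨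
    ∑² (λ u v → ⟦ T? (adjacent u v) ⟧ + ⟦ samePair? _≟_ u v x z ⟧)
      ≡⟨ ∑²-cong pointwise ⟨
    ∑² (λ u v → ⟦ T? (adjacent′ u v) ⟧ + ⟦ samePair? _≟_ u v x y ⟧)
      ≡⟨ ∑²-+ (λ u v → ⟦ T? (adjacent′ u v) ⟧) (λ u v → ⟦ samePair? _≟_ u v x y ⟧) ⟩
    degreeSum Γ′ + ∑² (λ u v → ⟦ samePair? _≟_ u v x y ⟧)
      ≡⟨ cong (degreeSum Γ′ +_) (∑²-samePair x≢y) ⟩
    degreeSum Γ′ + 2 ∎)
    where
    open ≡-Reasoning
    open SlideAt s
    open SimpleGraph Γ
    open SimpleGraph Γ′ using () renaming (adjacent to adjacent′)

    pointwise : ∀ u v → ⟦ T? (adjacent′ u v) ⟧ + ⟦ samePair? _≟_ u v x y ⟧ ≡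
                        ⟦ T? (adjacent u v) ⟧ + ⟦ samePair? _≟_ u v x z ⟧
    pointwise u v = trans
      (cong (_+ ⟦ xy? ⟧) (⟦⟧-cong (replaced u v) (T? _) ((T? _ ×-dec ¬? xy?) ⊎-dec xz?)))
      (⟦⟧-exchange (SamePair-~ Γ x~y) (SamePair-≁ Γ x≁z) (T? _) xy? xz?)
      where
      xy? = samePair? _≟_ u v x y
      xz? = samePair? _≟_ u v x z

  Slides-degreeSum : ∀ {Γ Γ′} → Star Slide Γ Γ′ → degreeSum Γ ≡ degreeSum Γ′
  Slides-degreeSum = fold (λ Γ Γ′ → degreeSum Γ ≡ degreeSum Γ′) (trans ∘ Slide-degreeSum) refl

  -- Reaching a dominating vertex

  -- The measure that decreases in `dominate`. The vertex `r` is counted too, which adds the same 1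
  -- for every graph.
  codegree : V → SimpleGraph V → ℕ
  codegree r Γ = ∑ λ v → ⟦ ¬? (T? (adjacent r v)) ⟧
    where open SimpleGraph Γ

  -- A walk from `r` to `z` must leave the closed neighbourhood of `r`; its first step out is `yw`.
  -- The invariant of `go` is that the current vertex still lies in that neighbourhood.
  distance-two : ∀ Γ → Connected Γ → (let open SimpleGraph Γ) → ∀ {r z} → z ≢ r → r ≁ z →
                 ∃[ y ] ∃[ w ] (r ~ y × y ~ w × r ≁ w × w ≢ r)
  distance-two Γ conn {r} {z} z≢r r≁z = go (inj₁ refl) (conn r z)
    where
    open SimpleGraph Γ

    go : ∀ {x} → x ≡ r ⊎ r ~ x → Star _~_ x z → ∃[ y ] ∃[ w ] (r ~ y × y ~ w × r ≁ w × w ≢ r)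
    go (inj₁ z≡r) ε = contradiction z≡r z≢r
    go (inj₂ r~z) ε = contradiction r~z r≁z
    go (inj₁ refl) (r~x′ ◅ walk) = go (inj₂ r~x′) walk
    go (inj₂ r~x) (_◅_ {j = x′} x~x′ walk) with x′ ≟ r | T? (adjacent r x′)
    ... | yes x′≡r | _        = go (inj₁ x′≡r) walk
    ... | no _     | yes r~x′ = go (inj₂ r~x′) walk
    ... | no x′≢r  | no r≁x′  = _ , x′ , r~x , x~x′ , r≁x′ , x′≢r

  dominate : ∀ r Γ → Connected Γ → ∃[ Γ′ ] (Star Slide Γ Γ′ × Dominates _≟_ r Γ′)
  dominate r Γ conn = go Γ conn (<-wellFounded (codegree r Γ))
    where
    go : ∀ Γ → Connected Γ → Acc _<_ (codegree r Γ) →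
         ∃[ Γ′ ] (Star Slide Γ Γ′ × Dominates _≟_ r Γ′)
    go Γ conn (acc rec) with search (λ z → ¬? (z ≟ r) ×-dec ¬? (T? (SimpleGraph.adjacent Γ r z)))
    ... | no  none = Γ , ε , λ v v≢r → decidable-stable (T? _) λ r≁v → none (v , v≢r , r≁v)
    ... | yes (z , z≢r , r≁z) with distance-two Γ conn z≢r r≁z
    ...   | y , w , r~y , y~w , r≁w , w≢r =
      let Γ″ , ss′ , dom = go Γ′ conn′ (rec decreasing) in Γ″ , ss ◅◅ ss′ , dom
      where
      open SimpleGraph Γ
      w≁r = r≁w ∘ ~-sym
      s = slide _≟_ Γ (~-sym y~w) (~-sym r~y) w≁r w≢r
      Γ′ = proj₁ s
      ss = proj₁ (proj₂ s)
      open Replaces (proj₂ (proj₂ s))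
      open SimpleGraph Γ′ using () renaming (~-sym to ~′-sym)

      conn′ : Connected Γ′
      conn′ = fold (λ Γ Γ′ → Connected Γ → Connected Γ′)
        (λ t f → f ∘ Slide-connected _≟_ t) id ss conn

      decreasing : codegree r Γ′ < codegree r Γ
      -- The removed pair `wy` avoids `r`, so `r` loses no neighbour, and it gains `w`.
      decreasing = ∑-mono-<
        (λ v → ⟦⟧-mono-≤
          (λ r≁′v r~v → r≁′v (kept r~v [ ≢-sym w≢r ∘ proj₁ , ~⇒≢ Γ r~y ∘ proj₁ ]))
          (¬? (T? _)) (¬? (T? _)))
        w (⟦⟧-mono-< (λ r≁′w → r≁′w (~′-sym added)) r≁w (¬? (T? _)) (¬? (T? _)))

  -- Matching two dominated graphs

  excess? : ∀ (Γ Δ : SimpleGraph V) u v →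
            Dec (T (SimpleGraph.adjacent Γ u v) × ¬ T (SimpleGraph.adjacent Δ u v))
  excess? Γ Δ u v = T? _ ×-dec ¬? (T? _)

  excess : SimpleGraph V → SimpleGraph V → ℕ
  excess Γ Δ = ∑² λ u v → ⟦ excess? Γ Δ u v ⟧

  -- Each degree sum splits into the pairs common to both graphs and the excess; the common part is
  -- symmetric and cancels.
  excess-comm : ∀ Γ Δ → degreeSum Γ ≡ degreeSum Δ → excess Γ Δ ≡ excess Δ Γ
  excess-comm Γ Δ eq = +-cancelˡ-≡ (common Γ Δ) _ _ (begin
    common Γ Δ + excess Γ Δ ≡⟨ split Γ Δ ⟨
    degreeSum Γ             ≡⟨ eq ⟩
    degreeSum Δ             ≡⟨ split Δ Γ ⟩
    common Δ Γ + excess Δ Γ ≡⟨ cong (_+ excess Δ Γ) (∑²-cong λ u v →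
                                 ⟦⟧-cong (mk⇔ swap swap) (common? Δ Γ u v) (common? Γ Δ u v)) ⟩
    common Γ Δ + excess Δ Γ ∎)
    where
    open ≡-Reasoning

    common? : ∀ (Γ Δ : SimpleGraph V) u v →
              Dec (T (SimpleGraph.adjacent Γ u v) × T (SimpleGraph.adjacent Δ u v))
    common? Γ Δ u v = T? _ ×-dec T? _

    common : SimpleGraph V → SimpleGraph V → ℕ
    common Γ Δ = ∑² λ u v → ⟦ common? Γ Δ u v ⟧

    split : ∀ Γ Δ → degreeSum Γ ≡ common Γ Δ + excess Γ Δ
    split Γ Δ = trans
      (∑²-cong λ u v → ⟦⟧-split (T? (SimpleGraph.adjacent Γ u v)) (T? (SimpleGraph.adjacent Δ u v)))
      (∑²-+ (λ u v → ⟦ common? Γ Δ u v ⟧) (λ u v → ⟦ excess? Γ Δ u v ⟧))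

  findExcess : ∀ Γ Δ → Dec (∃ λ u → ∃ λ v →
                 T (SimpleGraph.adjacent Γ u v) × ¬ T (SimpleGraph.adjacent Δ u v))
  findExcess Γ Δ = search λ u → search λ v → excess? Γ Δ u v

  match : ∀ r Γ Δ → Dominates _≟_ r Γ → Dominates _≟_ r Δ → degreeSum Γ ≡ degreeSum Δ →
          ∃[ Γ′ ] (Star Slide Γ Γ′ × Γ′ ≈ Δ)
  match r Γ Δ domΓ domΔ eq = go Γ domΓ eq (<-wellFounded (excess Γ Δ))
    where
    open SimpleGraph Δ using () renaming (~-sym to ~Δ-sym; ~-irrefl to ~Δ-irrefl)

    -- If one end were `r`, the other, being distinct from it, would be joined to it in `Δ`. The
    -- graphs are quantified afresh because the fact is used in both directions.
    avoids : ∀ Γ Δ → Dominates _≟_ r Δ → ∀ {u v} → T (SimpleGraph.adjacent Γ u v) →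
             ¬ T (SimpleGraph.adjacent Δ u v) → u ≢ r × v ≢ r
    avoids Γ Δ dom u~v u≁v =
      (λ { refl → u≁v (dom _ (≢-sym (~⇒≢ Γ u~v))) }) ,
      (λ { refl → u≁v (SimpleGraph.~-sym Δ (dom _ (~⇒≢ Γ u~v))) })

    go : ∀ Γ → Dominates _≟_ r Γ → degreeSum Γ ≡ degreeSum Δ → Acc _<_ (excess Γ Δ) →
         ∃[ Γ′ ] (Star Slide Γ Γ′ × Γ′ ≈ Δ)
    go Γ dom eq (acc rec) with findExcess Γ Δ | findExcess Δ Γ
    -- Every edge of `Γ` lies in `Δ`; by equal degree sums the excess of `Δ` over `Γ` vanishes as
    -- well, so the graphs agree.
    ... | no none | _ = Γ , ε , λ u v → mk⇔
      (λ u~v → decidable-stable (T? _) λ u≁v → none (u , v , u~v , u≁v))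
      (λ u~v → decidable-stable (T? _) λ u≁v →
        ⟦⟧-zero⁻¹ (excess? Δ Γ u v) (∑²-zero⁻¹ noExcess u v) (u~v , u≁v))
      where
      noExcess : excess Δ Γ ≡ 0
      noExcess = trans (sym (excess-comm Γ Δ eq))
        (∑²-zero λ u v → ⟦⟧-zero (λ e → none (u , v , e)) (excess? Γ Δ u v))
    ... | yes (x , y , e) | no none = contradiction e
      (⟦⟧-zero⁻¹ (excess? Γ Δ x y) (∑²-zero⁻¹ noExcess x y))
      where
      noExcess : excess Γ Δ ≡ 0
      noExcess = trans (excess-comm Γ Δ eq)
        (∑²-zero λ u v → ⟦⟧-zero (λ e → none (u , v , e)) (excess? Δ Γ u v))
    ... | yes (x , y , x~y , x≁y) | yes (z , w , z~w , z≁w) =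
      let Γ″ , ss′ , Γ″≈Δ = go Γ′ (Replaces-dominates _≟_ x≢r y≢r R dom)
                               (trans (sym (Slides-degreeSum ss)) eq) (rec decreasing)
      in Γ″ , ss ◅◅ ss′ , Γ″≈Δ
      where
      x≢r = proj₁ (avoids Γ Δ domΔ x~y x≁y)
      y≢r = proj₂ (avoids Γ Δ domΔ x~y x≁y)
      z≢r = proj₁ (avoids Δ Γ dom z~w z≁w)
      w≢r = proj₂ (avoids Δ Γ dom z~w z≁w)
      m = move _≟_ Γ dom x≢r y≢r z≢r w≢r (~⇒≢ Δ z~w) x~y z≁w
      Γ′ = proj₁ m
      ss = proj₁ (proj₂ m)
      R = proj₂ (proj₂ m)
      open Replaces R

      xy≢zw : ¬ SamePair x y z w
      xy≢zw xy≡zw = x≁y (SamePair-~ Δ z~w xy≡zw)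

      decreasing : excess Γ′ Δ < excess Γ Δ
      -- The gained `zw` is an edge of `Δ` and creates no excess, while `xy`, which was excess, is
      -- gone.
      decreasing = ∑²-mono-<
        (λ u v → ⟦⟧-mono-≤ (λ (u~′v , u≁v) → old u~′v (u≁v ∘ SamePair-~ Δ z~w) , u≁v)
          (excess? Γ′ Δ u v) (excess? Γ Δ u v))
        x y (⟦⟧-mono-< (removed xy≢zw ∘ proj₁) (x~y , x≁y) (excess? Γ′ Δ x y) (excess? Γ Δ x y))

  slide-equivalent : ∀ Γ Δ → Connected Γ → Connected Δ → degreeSum Γ ≡ degreeSum Δ →
                     ∃[ Γ′ ] (Star Slide Γ Γ′ × Γ′ ≈ Δ)
  -- Searching for the trivial property decides whether there is any vertex to serve as `r`. If
  -- there is none, the two graphs agree vacuously.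
  slide-equivalent Γ Δ connΓ connΔ eq with search {P = λ _ → ⊤} (λ _ → yes tt)
  ... | no empty = Γ , ε , λ u _ → contradiction (u , tt) empty
  ... | yes (r , _) =
    let Γ₁ , Γ⇒Γ₁ , domΓ₁ = dominate r Γ connΓ
        Δ₁ , Δ⇒Δ₁ , domΔ₁ = dominate r Δ connΔ
        Γ₂ , Γ₁⇒Γ₂ , Γ₂≈Δ₁ = match r Γ₁ Δ₁ domΓ₁ domΔ₁
          (trans (sym (Slides-degreeSum Γ⇒Γ₁)) (trans eq (Slides-degreeSum Δ⇒Δ₁)))
        Γ₃ , Γ₂⇒Γ₃ , Γ₃≈Δ = Slides-respˡ-≈ Γ₂≈Δ₁ (reverse (Slide-sym _≟_) Δ⇒Δ₁)
    in Γ₃ , Γ⇒Γ₁ ◅◅ Γ₁⇒Γ₂ ◅◅ Γ₂⇒Γ₃ , Γ₃≈Δ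

-- Transport along a bijection

module _ {V : Set a} {W : Set b} (φ : V ↔ W) (Δ : SimpleGraph W) where
  open Inverse φ using () renaming (to to f; from to g; strictlyInverseˡ to f∘g; strictlyInverseʳ to g∘f)
  open SimpleGraph Δ

  pullback : SimpleGraph V
  pullback = record
    { adjacent = λ u v → adjacent (f u) (f v)
    ; ~-sym    = ~-sym
    ; ~-irrefl = ~-irrefl
    }

  -- A walk of `Δ` from `f u` to `f v` is mapped by `g`; it then joins `g (f u)` to `g (f v)`, which
  -- are `u` and `v`.
  pullback-connected : Connected Δ → Connected pullback
  pullback-connected conn u v = subst₂ (Star (SimpleGraph._~_ pullback)) (g∘f u) (g∘f v)
    (gmap g (λ {x} {y} → subst₂ _~_ (sym (f∘g x)) (sym (f∘g y))) (conn (f u) (f v)))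

  -- Read through the two enumerations, `φ` becomes a bijection `π` of index sets, along which both
  -- summations are reindexed.
  pullback-degreeSum : ∀ finV finW → degreeSum finV pullback ≡ degreeSum finW Δ
  pullback-degreeSum finV finW = sym (begin
    sum (λ i → sum (λ j → ⟦ T? (adjacent (w i) (w j)) ⟧))
      ≡⟨ sum-permute (λ i → sum (λ j → ⟦ T? (adjacent (w i) (w j)) ⟧)) π ⟩
    sum (λ i → sum (λ j → ⟦ T? (adjacent (w (to′ i)) (w j)) ⟧))
      ≡⟨ (sum-cong-≗ λ i → sum-permute (λ j → ⟦ T? (adjacent (w (to′ i)) (w j)) ⟧) π) ⟩
    sum (λ i → sum (λ j → ⟦ T? (adjacent (w (to′ i)) (w (to′ j))) ⟧))
      ≡⟨ (sum-cong-≗ λ i → sum-cong-≗ λ j →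
           cong₂ (λ x y → ⟦ T? (adjacent x y) ⟧) (w∘to′ i) (w∘to′ j)) ⟩
    sum (λ i → sum (λ j → ⟦ T? (adjacent (f (v i)) (f (v j))) ⟧)) ∎)
    where
    open ≡-Reasoning
    open Inverse (Finite.enum finV) using () renaming (from to v)
    open Inverse (Finite.enum finW) using () renaming (from to w; strictlyInverseʳ to w-index)
    π = ↔-trans (↔-sym (Finite.enum finV)) (↔-trans φ (Finite.enum finW))
    to′ = Inverse.to π

    w∘to′ : ∀ i → w (to′ i) ≡ f (v i)
    w∘to′ i = w-index (f (v i))

theorem3p1 : ∀ {a b} {V : Set a} {W : Set b}
    (finV : Finite V) (finW : Finite W)
    (Γ : SimpleGraph V) (Σ : SimpleGraph W) →
    Connected Γ → Connected Σ →
    Finite.size finV ≡ Finite.size finW →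
    edgeCount finV Γ ≡ edgeCount finW Σ →
    (ψ : V ⤖ W) →
    ∃[ Γ̃ ] (Star Slide Γ Γ̃ × IsIsomorphism Γ̃ Σ ψ)
theorem3p1 finV finW Γ Σ connΓ connΣ _ |E|≡|F| ψ =
  -- Agreeing with the pullback of `Σ` is by definition the same as `ψ` being an isomorphism onto
  -- `Σ`.
  slide-equivalent finV Γ (pullback φ Σ) connΓ (pullback-connected φ Σ connΣ) (begin
    degreeSum finV Γ                    ≡⟨ handshake finV Γ ⟩
    edgeCount finV Γ + edgeCount finV Γ ≡⟨ cong₂ _+_ |E|≡|F| |E|≡|F| ⟩
    edgeCount finW Σ + edgeCount finW Σ ≡⟨ handshake finW Σ ⟨
    degreeSum finW Σ                    ≡⟨ pullback-degreeSum φ Σ finV finW ⟨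
    degreeSum finV (pullback φ Σ)       ∎)
  where
  open ≡-Reasoning
  φ = ⤖⇒↔ ψ
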